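{- For every BBI formula $A$: if $A$ is valid (forced at every world of every model), then for every label variable $w\in LVar$ the sequent $\emptyset\vdash w:A$ (empty antecedent) is derivable in $LS_{BBI}$.
   Context: BBI formulae: $A ::= p \mid \top \mid \bot \mid \neg A \mid A\lor A \mid A\land A \mid A\to A \mid \top^* \mid A * A \mid A \mathrel{ -\!*} A$, $p$ atomic; in the calculus $\neg A$ abbreviates $A\to\bot$ and $A\lor B$ abbreviates $\neg(\neg A\land\neg B)$. Semantics. A frame is $(\mathcal{M},\triangleright,\epsilon)$ with $\mathcal{M}$ nonempty, $\epsilon\in\mathcal{M}$, $\triangleright\subseteq\mathcal{M}^3$ (written $a,b\triangleright c$) such that for all $a,b,c,d$: $\epsilon,a\triangleright b$ iff $a=b$; $a,b\triangleright c$ iff $b,a\triangleright c$; if $a,k\triangleright d$ and $b,c\triangleright k$ for some $k$, then there is $l$ with $a,b\triangleright l$ and $l,c\triangleright d$. A model adds a valuation $v$ from atoms to subsets of $\mathcal{M}$. Forcing: $m\Vdash p$ iff $m\in v(p)$; $m\Vdash\top^*$ iff $m=\epsilon$; $\top$ always, $\bot$ never; $\land,\lor,\to,\neg$ classical pointwise; $m\Vdash A*B$ iff there are $a,b$ with $a,b\triangleright m$, $a\Vdash A$, $b\Vdash B$; $m\Vdash A\mathrel{ -\!*}B$ iff for all $a,b$, if $m,a\triangleright b$ and $a\Vdash A$ then $b\Vdash B$. $A$ is valid iff $m\Vdash A$ for every $m$ in every model. Syntax of sequents. Labels are label variables (from an infinite set $LVar$) or the constant $\epsilon$. A labelled formula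 is $w:A$; a relational atom is $(x,y\triangleright z)$ for labels $x,y,z$. A sequent $\Gamma\vdash\Delta$ has $\Gamma$ a finite multiset of labelled formulae and relational atoms and $\Delta$ a finite multiset of labelled formulae; ";" is multiset union. $\Gamma[y/x]$ replaces every occurrence of label $x$ by $y$. Rules of $LS_{BBI}$ ("from premises infer conclusion"; $P$ atomic): id: infer $\Gamma;w:P\vdash w:P;\Delta$. $\bot L$: infer $\Gamma;w:\bot\vdash\Delta$. $\top R$: infer $\Gamma\vdash w:\top;\Delta$. $\top^*R$: infer $\Gamma\vdash\epsilon:\top^*;\Delta$. cut: from $\Gamma\vdash x:A;\Delta$ and $\Gamma';x:A\vdash\Delta'$ infer $\Gamma;\Gamma'\vdash\Delta;\Delta'$. $\top^*L$: from $\Gamma[\epsilon/w]\vdash\Delta[\epsilon/w]$ infer $\Gamma;w:\top^*\vdash\Delta$ ($w\neq\epsilon$). $\land L$: from $\Gamma;w:A;w:B\vdash\Delta$ infer $\Gamma;w:A\land B\vdash\Delta$. $\land R$: from $\Gamma\vdash w:A;\Delta$ and $\Gamma\vdash w:B;\Delta$ infer $\Gamma\vdash w:A\land B;\Delta$. $\to L$: from $\Gamma\vdash w:A;\Delta$ and $\Gamma;w:B\vdash\Delta$ infer $\Gamma;w:A\to B\vdash\Delta$. $\to R$: from $\Gamma;w:A\vdash w:B;\Delta$ infer $\Gamma\vdash w:A\to B;\Delta$. $*L$: from $(x,y\triangleright z);\Gamma;x:A;y:B\vdash\Delta$ infer $\Gamma;z:A*B\vdash\Delta$ ($x,y$ not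 in the conclusion). $\mathrel{ -\!*}R$: from $(x,y\triangleright z);\Gamma;x:A\vdash z:B;\Delta$ infer $\Gamma\vdash y:A\mathrel{ -\!*}B;\Delta$ ($x,z$ not in the conclusion). $*R$: from $(x,y\triangleright z);\Gamma\vdash x:A;z:A*B;\Delta$ and $(x,y\triangleright z);\Gamma\vdash y:B;z:A*B;\Delta$ infer $(x,y\triangleright z);\Gamma\vdash z:A*B;\Delta$. $\mathrel{ -\!*}L$: from $(x,y\triangleright z);\Gamma;y:A\mathrel{ -\!*}B\vdash x:A;\Delta$ and $(x,y\triangleright z);\Gamma;y:A\mathrel{ -\!*}B;z:B\vdash\Delta$ infer $(x,y\triangleright z);\Gamma;y:A\mathrel{ -\!*}B\vdash\Delta$. E: from $(y,x\triangleright z);(x,y\triangleright z);\Gamma\vdash\Delta$ infer $(x,y\triangleright z);\Gamma\vdash\Delta$. U: from $(x,\epsilon\triangleright x);\Gamma\vdash\Delta$ infer $\Gamma\vdash\Delta$. A: from $(u,w\triangleright z);(y,v\triangleright w);(x,y\triangleright z);(u,v\triangleright x);\Gamma\vdash\Delta$ infer $(x,y\triangleright z);(u,v\triangleright x);\Gamma\vdash\Delta$ ($w$ not in the conclusion). $A_C$: from $(x,w\triangleright x);(y,y\triangleright w);(x,y\triangleright x);\Gamma\vdash\Delta$ infer $(x,y\triangleright x);\Gamma\vdash\Delta$ ($w$ not in the conclusion). $Eq_1$: from $(\epsilon,w'\triangleright w');\Gamma[w'/w]\vdash\Delta[w'/w]$ infer $(\epsilon,w\triangleright w');\Gamma\vdash\Delta$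 ($w\neq\epsilon$). $Eq_2$: from $(\epsilon,w'\triangleright w');\Gamma[w'/w]\vdash\Delta[w'/w]$ infer $(\epsilon,w'\triangleright w);\Gamma\vdash\Delta$ ($w\neq\epsilon$). -}

module Defs where

open import Level using (0ℓ)
open import Data.Nat using (ℕ)
import Data.Nat as ℕ
open import Data.Product using (Σ; ∃; ∃-syntax; _×_; _,_)
open import Data.Sum using (_⊎_)
open import Data.Unit using (⊤)
open import Data.Empty using (⊥)
open import Data.List using (List; []; _∷_; _++_; map)
open import Data.List.Relation.Unary.Any using (Any)
open import Data.List.Relation.Binary.Permutation.Propositional using (_↭_)
open import Relation.Nullary using (¬_; Dec; yes; no)
open import Relation.Binary.PropositionalEquality using (_≡_; _≢_; refl; cong)

data Formula : Set where
  atom  : ℕ → Formula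
  `⊤    : Formula
  `⊥    : Formula
  `¬_   : Formula → Formula
  _`∨_  : Formula → Formula → Formula
  _`∧_  : Formula → Formula → Formula
  _`→_  : Formula → Formula → Formula
  `⊤*   : Formula
  _`*_  : Formula → Formula → Formula
  _`-*_ : Formula → Formula → Formula

-- Formulae of the calculus: ¬ and ∨ are abbreviations there.
data CFormula : Set where
  atom  : ℕ → CFormula
  `⊤    : CFormula
  `⊥    : CFormula
  _`∧_  : CFormula → CFormula → CFormula
  _`→_  : CFormula → CFormula → CFormula
  `⊤*   : CFormula
  _`*_  : CFormula → CFormula → CFormula
  _`-*_ : CFormula → CFormula → CFormula

unfoldAbbr : Formula → CFormula
unfoldAbbr (atom p)   = atom p
unfoldAbbr `⊤         = `⊤
unfoldAbbr `⊥         = `⊥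
unfoldAbbr (`¬ A)     = unfoldAbbr A `→ `⊥
unfoldAbbr (A `∨ B)   = ((unfoldAbbr A `→ `⊥) `∧ (unfoldAbbr B `→ `⊥)) `→ `⊥
unfoldAbbr (A `∧ B)   = unfoldAbbr A `∧ unfoldAbbr B
unfoldAbbr (A `→ B)   = unfoldAbbr A `→ unfoldAbbr B
unfoldAbbr `⊤*        = `⊤*
unfoldAbbr (A `* B)   = unfoldAbbr A `* unfoldAbbr B
unfoldAbbr (A `-* B)  = unfoldAbbr A `-* unfoldAbbr B

record Frame : Set₁ where
  field
    Carrier : Set
    R       : Carrier → Carrier → Carrier → Set   -- R a b c  means  a,b ▹ c
    e       : Carrier
    unit⇒   : ∀ a b → R e a b → a ≡ b
    unit⇐   : ∀ a b → a ≡ b → R e a b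
    comm⇒   : ∀ a b c → R a b c → R b a c
    comm⇐   : ∀ a b c → R b a c → R a b c
    assoc   : ∀ a b c d k → R a k d → R b c k →
              ∃[ l ] (R a b l × R l c d)

record Model : Set₁ where
  field
    frame : Frame
  open Frame frame public
  field
    val : ℕ → Carrier → Set

module _ (𝓜 : Model) where
  open Model 𝓜

  _⊩_ : Carrier → Formula → Set
  m ⊩ atom p   = val p m
  m ⊩ `⊤       = ⊤
  m ⊩ `⊥       = ⊥
  m ⊩ (`¬ A)   = ¬ (m ⊩ A)
  m ⊩ (A `∨ B) = (m ⊩ A) ⊎ (m ⊩ B)
  m ⊩ (A `∧ B) = (m ⊩ A) × (m ⊩ B)
  m ⊩ (A `→ B) = m ⊩ A → m ⊩ B
  m ⊩ `⊤*      = m ≡ e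
  m ⊩ (A `* B) = ∃[ a ] ∃[ b ] (R a b m × a ⊩ A × b ⊩ B)
  m ⊩ (A `-* B) = ∀ a b → R m a b → a ⊩ A → b ⊩ B

Valid : Formula → Set₁
Valid A = (𝓜 : Model) (m : Model.Carrier 𝓜) → _⊩_ 𝓜 m A

LVar : Set
LVar = ℕ

data Label : Set where
  var : LVar → Label
  ε   : Label

_≟L_ : (x y : Label) → Dec (x ≡ y)
var m ≟L var n with m ℕ.≟ n
... | yes refl = yes refl
... | no m≢n   = no λ { refl → m≢n refl }
var m ≟L ε     = no λ ()
ε ≟L var n     = no λ ()
ε ≟L ε         = yes refl

record LFormula : Set where
  constructor _∶_
  field
    lab : Label
    fml : CFormula

data Ant : Set where
  fm  : LFormula → Ant
  rel : Label → Label → Label → Ant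

substL : Label → Label → Label → Label
substL y x l with l ≟L x
... | yes _ = y
... | no  _ = l

substF : Label → Label → LFormula → LFormula
substF y x (l ∶ A) = substL y x l ∶ A

substA : Label → Label → Ant → Ant
substA y x (fm f)      = fm (substF y x f)
substA y x (rel a b c) = rel (substL y x a) (substL y x b) (substL y x c)

_[_/_]A : List Ant → Label → Label → List Ant
Γ [ y / x ]A = map (substA y x) Γ

_[_/_]F : List LFormula → Label → Label → List LFormula
Δ [ y / x ]F = map (substF y x) Δ

data OccF (n : LVar) : LFormula → Set where
  here : ∀ {A} → OccF n (var n ∶ A)

data OccA (n : LVar) : Ant → Set where
  inF  : ∀ {f} → OccF n f → OccA n (fm f)
  in₁  : ∀ {b c} → OccA n (rel (var n) b c)
  in₂  : ∀ {a c} → OccA n (rel a (var n) c)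
  in₃  : ∀ {a b} → OccA n (rel a b (var n))

Fresh : LVar → List Ant → List LFormula → Set
Fresh n Γ Δ = ¬ (Any (OccA n) Γ ⊎ Any (OccF n) Δ)

-- The calculus LS_BBI.  Sequents are pairs of lists; multisets are
-- represented as lists up to permutation (rule `perm`).

infix 4 _⊢_
data _⊢_ : List Ant → List LFormula → Set where
  perm  : ∀ {Γ Γ' Δ Δ'} → Γ ↭ Γ' → Δ ↭ Δ' → Γ ⊢ Δ → Γ' ⊢ Δ'
  id    : ∀ {Γ Δ w p} → fm (w ∶ atom p) ∷ Γ ⊢ (w ∶ atom p) ∷ Δ
  ⊥L    : ∀ {Γ Δ w} → fm (w ∶ `⊥) ∷ Γ ⊢ Δ
  ⊤R    : ∀ {Γ Δ w} → Γ ⊢ (w ∶ `⊤) ∷ Δ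
  ⊤*R   : ∀ {Γ Δ} → Γ ⊢ (ε ∶ `⊤*) ∷ Δ
  cut   : ∀ {Γ Γ' Δ Δ' x A} →
          Γ ⊢ (x ∶ A) ∷ Δ → fm (x ∶ A) ∷ Γ' ⊢ Δ' → Γ ++ Γ' ⊢ Δ ++ Δ'
  ⊤*L   : ∀ {Γ Δ} (w : LVar) →
          Γ [ ε / var w ]A ⊢ Δ [ ε / var w ]F →
          fm (var w ∶ `⊤*) ∷ Γ ⊢ Δ
  ∧L    : ∀ {Γ Δ w A B} → fm (w ∶ A) ∷ fm (w ∶ B) ∷ Γ ⊢ Δ →
          fm (w ∶ (A `∧ B)) ∷ Γ ⊢ Δ
  ∧R    : ∀ {Γ Δ w A B} → Γ ⊢ (w ∶ A) ∷ Δ → Γ ⊢ (w ∶ B) ∷ Δ →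
          Γ ⊢ (w ∶ (A `∧ B)) ∷ Δ
  →L    : ∀ {Γ Δ w A B} → Γ ⊢ (w ∶ A) ∷ Δ → fm (w ∶ B) ∷ Γ ⊢ Δ →
          fm (w ∶ (A `→ B)) ∷ Γ ⊢ Δ
  →R    : ∀ {Γ Δ w A B} → fm (w ∶ A) ∷ Γ ⊢ (w ∶ B) ∷ Δ →
          Γ ⊢ (w ∶ (A `→ B)) ∷ Δ
  *L    : ∀ {Γ Δ z A B} (x y : LVar) → x ≢ y →
          Fresh x (fm (z ∶ (A `* B)) ∷ Γ) Δ →
          Fresh y (fm (z ∶ (A `* B)) ∷ Γ) Δ →
          rel (var x) (var y) z ∷ Γ ++ fm (var x ∶ A) ∷ fm (var y ∶ B) ∷ [] ⊢ Δ →
          fm (z ∶ (A `* B)) ∷ Γ ⊢ Δ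
  -*R   : ∀ {Γ Δ y A B} (x z : LVar) → x ≢ z →
          Fresh x Γ ((y ∶ (A `-* B)) ∷ Δ) →
          Fresh z Γ ((y ∶ (A `-* B)) ∷ Δ) →
          rel (var x) y (var z) ∷ fm (var x ∶ A) ∷ Γ ⊢ (var z ∶ B) ∷ Δ →
          Γ ⊢ (y ∶ (A `-* B)) ∷ Δ
  *R    : ∀ {Γ Δ x y z A B} →
          rel x y z ∷ Γ ⊢ (x ∶ A) ∷ (z ∶ (A `* B)) ∷ Δ →
          rel x y z ∷ Γ ⊢ (y ∶ B) ∷ (z ∶ (A `* B)) ∷ Δ →
          rel x y z ∷ Γ ⊢ (z ∶ (A `* B)) ∷ Δ
  -*L   : ∀ {Γ Δ x y z A B} →
          rel x y z ∷ fm (y ∶ (A `-* B)) ∷ Γ ⊢ (x ∶ A) ∷ Δ →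
          rel x y z ∷ fm (y ∶ (A `-* B)) ∷ fm (z ∶ B) ∷ Γ ⊢ Δ →
          rel x y z ∷ fm (y ∶ (A `-* B)) ∷ Γ ⊢ Δ
  E     : ∀ {Γ Δ x y z} → rel y x z ∷ rel x y z ∷ Γ ⊢ Δ → rel x y z ∷ Γ ⊢ Δ
  U     : ∀ {Γ Δ} x → rel x ε x ∷ Γ ⊢ Δ → Γ ⊢ Δ
  A     : ∀ {Γ Δ x y z u v} (w : LVar) →
          Fresh w (rel x y z ∷ rel u v x ∷ Γ) Δ →
          rel u (var w) z ∷ rel y v (var w) ∷ rel x y z ∷ rel u v x ∷ Γ ⊢ Δ →
          rel x y z ∷ rel u v x ∷ Γ ⊢ Δ
  AC    : ∀ {Γ Δ x y} (w : LVar) →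
          Fresh w (rel x y x ∷ Γ) Δ →
          rel x (var w) x ∷ rel y y (var w) ∷ rel x y x ∷ Γ ⊢ Δ →
          rel x y x ∷ Γ ⊢ Δ
  Eq₁   : ∀ {Γ Δ w'} (w : LVar) →
          rel ε w' w' ∷ Γ [ w' / var w ]A ⊢ Δ [ w' / var w ]F →
          rel ε (var w) w' ∷ Γ ⊢ Δ
  Eq₂   : ∀ {Γ Δ w'} (w : LVar) →
          rel ε w' w' ∷ Γ [ w' / var w ]A ⊢ Δ [ w' / var w ]F →
          rel ε w' (var w) ∷ Γ ⊢ Δ

{-# OPTIONS --safe #-}

-- Suppose ⊢ w : A is underivable.  Reading every rule upwards preserves underivability of one
-- premise, so a fair sequence of rule applications yields a growing chain of underivable sequents,
-- in which every rule instance that becomes applicable is eventually applied.  Eq₁, Eq₂ and ⊤*L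
-- only identify labels; the labels modulo the identifications made along the chain form a frame,
-- with a , b ▹ c when such an atom occurs at some stage, and in the model where p holds exactly at
-- the x for which x : p occurs on the left, every formula occurring on the left (right) of some
-- stage holds (fails) at its label.  In particular A fails at w.
--
-- The argument is cut-free and needs neither weakening nor contraction: a rule may consume its
-- principal formula, because a record of all formulas ever seen is kept next to the sequent.
module Submission where

open import Defs
open import Level using (0ℓ)
open import Axiom.ExcludedMiddle using (ExcludedMiddle)
open import Axiom.UniquenessOfIdentityProofs using (module Decidable⇒UIP)
open import Data.Nat using (ℕ; zero; suc; _+_; _≤_; _<_; _∸_; _⊔_; z≤n; s≤s)
open import Data.Nat.Properties
  using (≤-refl; ≤-trans; ≤-antisym; <-irrefl; <-≤-trans; n≤1+n; m≤n+m; ≮⇒≥; m∸n+n≡m;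
         m≤m⊔n; m≤n⊔m; ≰⇒>; _≤?_; 1+n≢n)
open import Data.Nat.Induction using (<-rec)
open import Data.Product using (∃; ∃-syntax; ∃₂; _×_; _,_; proj₁; proj₂)
open import Data.Sum using (_⊎_; inj₁; inj₂)
import Data.Sum as Sum
open import Data.Unit using (⊤; tt)
open import Data.Empty using (⊥; ⊥-elim)
open import Data.List using (List; []; _∷_; _++_; map; upTo; cartesianProductWith)
open import Data.List.Properties using (map-∘; map-cong)
open import Data.List.Relation.Unary.Any using (here; there)
open import Data.List.Relation.Unary.All as All using (All; []; _∷_)
import Data.List.Relation.Unary.All.Properties as All
open import Data.List.Membership.Propositional using (_∈_)
open import Data.List.Membership.Propositional.Properties
  using (∈-map⁺; ∈-++⁺ˡ; ∈-++⁺ʳ; ∈-++⁻; ∈-∃++; ∈-upTo⁺; ∈-cartesianProductWith⁺)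
open import Data.List.Relation.Binary.Permutation.Propositional
  using (_↭_; ↭-refl; ↭-sym; ↭-trans; prep; swap)
open import Data.List.Relation.Binary.Permutation.Propositional.Properties
  using (∈-resp-↭; Any-resp-↭; All-resp-↭; shift; ++-comm)
  renaming (map⁺ to ↭-map⁺)
open import Function using (_∘_; case_of_)
open import Relation.Nullary using (¬_; yes; no)
open import Relation.Binary.PropositionalEquality
  using (_≡_; _≢_; refl; sym; trans; cong; subst; subst₂)

-- Derived forms of the rules, with principal parts located by membership.

pick : ∀ {T : Set} {x : T} {xs} → x ∈ xs → ∃[ ys ] (xs ↭ x ∷ ys)
pick x∈xs with ∈-∃++ x∈xs
... | ys , zs , refl = ys ++ zs , shift _ ys zs

private
  variable
    Γ Γ₁ : List Ant
    Δ Δ₁ : List LFormula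
    F G : CFormula
    n : ℕ
    x y z u v w : Label

Fresh-resp-↭ : ∀ {k} → Γ ↭ Γ₁ → Δ ↭ Δ₁ → Fresh k Γ Δ → Fresh k Γ₁ Δ₁
Fresh-resp-↭ p q fresh =
  fresh ∘ Sum.map (Any-resp-↭ (↭-sym p)) (Any-resp-↭ (↭-sym q))

onΓ : Γ ↭ Γ₁ → Γ ⊢ Δ → Γ₁ ⊢ Δ
onΓ p = perm p ↭-refl

identity : fm (x ∶ atom n) ∈ Γ → (x ∶ atom n) ∈ Δ → Γ ⊢ Δ
identity p q = perm (↭-sym (proj₂ (pick p))) (↭-sym (proj₂ (pick q))) id

⊥-closes : fm (x ∶ `⊥) ∈ Γ → Γ ⊢ Δ
⊥-closes p = onΓ (↭-sym (proj₂ (pick p))) ⊥L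

⊤-closes : (x ∶ `⊤) ∈ Δ → Γ ⊢ Δ
⊤-closes q = perm ↭-refl (↭-sym (proj₂ (pick q))) ⊤R

⊤*-closes : (ε ∶ `⊤*) ∈ Δ → Γ ⊢ Δ
⊤*-closes q = perm ↭-refl (↭-sym (proj₂ (pick q))) ⊤*R

-- `*R` keeps its atom and its principal formula in both premises, so each premise extends the whole
-- conclusion by one formula.
*R-∈ : rel x y z ∈ Γ → (z ∶ (F `* G)) ∈ Δ →
       Γ ⊢ (x ∶ F) ∷ Δ → Γ ⊢ (y ∶ G) ∷ Δ → Γ ⊢ Δ
*R-∈ r f d₁ d₂ with pick r | pick f
... | _ , p | _ , q = perm (↭-sym p) (↭-sym q)
  (*R (perm p (prep _ q) d₁) (perm p (prep _ q) d₂))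

-*L-∈ : rel x y z ∈ Γ → fm (y ∶ (F `-* G)) ∈ Γ →
        Γ ⊢ (x ∶ F) ∷ Δ → fm (z ∶ G) ∷ Γ ⊢ Δ → Γ ⊢ Δ
-*L-∈ r f d₁ d₂ with pick r
... | _ , p with ∈-resp-↭ p f
-- The head of the permuted antecedent is a relational atom, so the formula lies in the tail.
... | there f′ with pick f′
... | _ , q = onΓ (↭-sym pq)
  (-*L (onΓ pq d₁)
       (onΓ (↭-trans (prep _ pq) (↭-trans (swap _ _ ↭-refl) (prep _ (swap _ _ ↭-refl)))) d₂))
  where pq = ↭-trans p (prep _ q)

E-∈ : rel x y z ∈ Γ → rel y x z ∷ Γ ⊢ Δ → Γ ⊢ Δ
E-∈ r d with pick r
... | _ , p = onΓ (↭-sym p) (E (onΓ (prep _ p) d))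

-- When both memberships point to the same occurrence, A does not apply and A_C takes its place.
A-∈ : ∀ {k} → w ≡ var k → Fresh k Γ Δ → rel x y z ∈ Γ → rel u v x ∈ Γ →
      rel u w z ∷ rel y v w ∷ Γ ⊢ Δ → Γ ⊢ Δ
A-∈ refl fresh r₁ r₂ d with pick r₁
... | _ , p with ∈-resp-↭ p r₂
... | here refl = onΓ (↭-sym p)
  (AC _ (Fresh-resp-↭ p ↭-refl fresh) (onΓ (prep _ (prep _ p)) d))
... | there r₂′ with pick r₂′
... | _ , q = onΓ (↭-sym pq)
  (A _ (Fresh-resp-↭ pq ↭-refl fresh) (onΓ (prep _ (prep _ pq)) d))
  where pq = ↭-trans p (prep _ q)

-- In use, the eigenlabels are of the form `τ (var k)`, which equals `var k` only propositionally;
-- taking the equations as arguments avoids transporting the whole sequent.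
*L-≡ : ∀ {k l} → x ≡ var k → y ≡ var l → k ≢ l →
       Fresh k (fm (z ∶ (F `* G)) ∷ Γ) Δ → Fresh l (fm (z ∶ (F `* G)) ∷ Γ) Δ →
       rel x y z ∷ fm (x ∶ F) ∷ fm (y ∶ G) ∷ Γ ⊢ Δ → fm (z ∶ (F `* G)) ∷ Γ ⊢ Δ
*L-≡ {Γ = Γ} refl refl k≢l fk fl d =
  *L _ _ k≢l fk fl (onΓ (prep _ (++-comm (_ ∷ _ ∷ []) Γ)) d)

-*R-≡ : ∀ {k l} → x ≡ var k → z ≡ var l → k ≢ l →
        Fresh k Γ ((y ∶ (F `-* G)) ∷ Δ) → Fresh l Γ ((y ∶ (F `-* G)) ∷ Δ) →
        rel x y z ∷ fm (x ∶ F) ∷ Γ ⊢ (z ∶ G) ∷ Δ → Γ ⊢ (y ∶ (F `-* G)) ∷ Δ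
-*R-≡ refl refl = -*R _ _

substL-old : ∀ y x → substL y x x ≡ y
substL-old y x with x ≟L x
... | yes _ = refl
... | no x≢x = ⊥-elim (x≢x refl)

substL-new : ∀ y x → substL y x y ≡ y
substL-new y x with y ≟L x
... | yes _ = refl
... | no _ = refl

-- The atom `rel ε y y` which `Eq₁` adds to its premise is the image of the principal atom under the
-- substitution, so the premise is simply the whole sequent renamed.
Eq₁-∈ : ∀ {k} → rel ε (var k) y ∈ Γ → Γ [ y / var k ]A ⊢ Δ [ y / var k ]F → Γ ⊢ Δ
Eq₁-∈ {y = y} {Δ = Δ} {k = k} r d with pick r
... | Γ₀ , p = onΓ (↭-sym p) (Eq₁ k
  (subst₂ (λ a b → rel ε a b ∷ Γ₀ [ y / var k ]A ⊢ Δ [ y / var k ]F)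
    (substL-old y (var k)) (substL-new y (var k)) (onΓ (↭-map⁺ _ p) d)))

Eq₂-∈ : ∀ {k} → rel ε y (var k) ∈ Γ → Γ [ y / var k ]A ⊢ Δ [ y / var k ]F → Γ ⊢ Δ
Eq₂-∈ {y = y} {Δ = Δ} {k = k} r d with pick r
... | Γ₀ , p = onΓ (↭-sym p) (Eq₂ k
  (subst₂ (λ a b → rel ε a b ∷ Γ₀ [ y / var k ]A ⊢ Δ [ y / var k ]F)
    (substL-new y (var k)) (substL-old y (var k)) (onΓ (↭-map⁺ _ p) d)))

rel-≡ : x ≡ u → y ≡ v → z ≡ w → rel x y z ∈ Γ → rel u v w ∈ Γ
rel-≡ refl refl refl r = r

U-≡ : u ≡ ε → rel x u x ∷ Γ ⊢ Δ → Γ ⊢ Δ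
U-≡ refl = U _

-- Signed formulas and the bookkeeping of consumed ones.

data Side : Set where
  left right : Side

Signed : Set
Signed = Side × LFormula

signed : List Ant → List LFormula → List Signed
signed []                Δ = map (right ,_) Δ
signed (fm f ∷ Γ)        Δ = (left , f) ∷ signed Γ Δ
signed (rel _ _ _ ∷ Γ)   Δ = signed Γ Δ

Active : List Ant → List LFormula → Signed → Set
Active Γ Δ (left  , f) = fm f ∈ Γ
Active Γ Δ (right , f) = f ∈ Δ

Active⇒∈signed : ∀ Γ {s} → Active Γ Δ s → s ∈ signed Γ Δ
Active⇒∈signed [] {right , _} h = ∈-map⁺ (right ,_) h
Active⇒∈signed (fm _ ∷ _) {left , _} (here refl) = here refl
Active⇒∈signed (fm _ ∷ Γ) {left , _} (there h) = there (Active⇒∈signed Γ h)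
Active⇒∈signed (fm _ ∷ Γ) {right , _} h = there (Active⇒∈signed Γ h)
Active⇒∈signed (rel _ _ _ ∷ Γ) {left , _} (there h) = Active⇒∈signed Γ h
Active⇒∈signed (rel _ _ _ ∷ Γ) {right , _} h = Active⇒∈signed Γ h

there-Active : ∀ {g s} → Active Γ Δ s → Active (g ∷ Γ) Δ s
there-Active {s = left  , _} h = there h
there-Active {s = right , _} h = h

∈signed⇒Active : ∀ Γ {s} → s ∈ signed Γ Δ → Active Γ Δ s
∈signed⇒Active {f ∷ Δ} [] (here refl) = here refl
∈signed⇒Active {f ∷ Δ} [] {left , _} (there h) with () ← ∈signed⇒Active {Δ} [] h
∈signed⇒Active {f ∷ Δ} [] {right , _} (there h) = there (∈signed⇒Active {Δ} [] h)
∈signed⇒Active (fm _ ∷ _) (here refl) = here refl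
∈signed⇒Active (fm _ ∷ Γ) {s} (there h) = there-Active {s = s} (∈signed⇒Active Γ h)
∈signed⇒Active (rel _ _ _ ∷ Γ) {s} h = there-Active {s = s} (∈signed⇒Active Γ h)

-- How a formula that its rule has consumed is accounted for; τ says which labels have been
-- identified so far, H lists all formulas that have ever occurred.
Done : (Label → Label) → List Ant → List Signed → Signed → Set
Done τ Γ H (left , x ∶ (F `∧ G)) = (left , x ∶ F) ∈ H × (left , x ∶ G) ∈ H
Done τ Γ H (left , x ∶ (F `→ G)) = (right , x ∶ F) ∈ H ⊎ (left , x ∶ G) ∈ H
Done τ Γ H (left , x ∶ `⊤*) = τ x ≡ τ ε
Done τ Γ H (left , z ∶ (F `* G)) =
  ∃₂ λ x y → rel x y z ∈ Γ × (left , x ∶ F) ∈ H × (left , y ∶ G) ∈ H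
Done τ Γ H (right , x ∶ (F `∧ G)) = (right , x ∶ F) ∈ H ⊎ (right , x ∶ G) ∈ H
Done τ Γ H (right , x ∶ (F `→ G)) = (left , x ∶ F) ∈ H × (right , x ∶ G) ∈ H
Done τ Γ H (right , y ∶ (F `-* G)) =
  ∃₂ λ x z → rel x y z ∈ Γ × (left , x ∶ F) ∈ H × (right , z ∶ G) ∈ H
Done τ Γ H _ = ⊥

-- Atoms and these constants call for no decomposition. `-*` on the left and `*` on the right must
-- serve every matching relational atom, so they are never consumed and are handled by `combine`
-- goals.
Inert : Signed → Set
Inert (left  , _ ∶ (atom _))   = ⊤
Inert (left  , _ ∶ `⊤)         = ⊤
Inert (left  , _ ∶ `⊥)         = ⊤
Inert (left  , _ ∶ (_ `-* _))  = ⊤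
Inert (right , _ ∶ (atom _))   = ⊤
Inert (right , _ ∶ `⊤)         = ⊤
Inert (right , _ ∶ `⊥)         = ⊤
Inert (right , _ ∶ `⊤*)        = ⊤
Inert (right , _ ∶ (_ `* _))   = ⊤
Inert _                        = ⊥

Done-mono : ∀ {τ τ′ : Label → Label} {H H′} →
            (∀ {x y z} → rel x y z ∈ Γ → rel x y z ∈ Γ₁) →
            (∀ {s} → s ∈ H → s ∈ H′) →
            (∀ {x y} → τ x ≡ τ y → τ′ x ≡ τ′ y) →
            ∀ s → Done τ Γ H s → Done τ′ Γ₁ H′ s
Done-mono r h t (left  , _ ∶ (_ `∧ _))  (p , q) = h p , h q
Done-mono r h t (left  , _ ∶ (_ `→ _))  d = Sum.map h h d
Done-mono r h t (left  , _ ∶ `⊤*)       d = t d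
Done-mono r h t (left  , _ ∶ (_ `* _))  (_ , _ , o , p , q) = _ , _ , r o , h p , h q
Done-mono r h t (right , _ ∶ (_ `∧ _))  d = Sum.map h h d
Done-mono r h t (right , _ ∶ (_ `→ _))  (p , q) = h p , h q
Done-mono r h t (right , _ ∶ (_ `-* _)) (_ , _ , o , p , q) = _ , _ , r o , h p , h q

-- Label bounds, freshness and renamings.

Old : ℕ → Label → Set
Old N (var k) = k < N
Old N ε       = ⊤

OldF : ℕ → LFormula → Set
OldF N (x ∶ _) = Old N x

OldA : ℕ → Ant → Set
OldA N (fm f)      = OldF N f
OldA N (rel x y z) = Old N x × Old N y × Old N z

Old-mono : ∀ {M N} → M ≤ N → ∀ {x} → Old M x → Old N x
Old-mono M≤N {var _} k<M = <-≤-trans k<M M≤N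
Old-mono M≤N {ε} _ = tt

OldF-mono : ∀ {M N} → M ≤ N → ∀ {f} → OldF M f → OldF N f
OldF-mono M≤N {_ ∶ _} = Old-mono M≤N

OldA-mono : ∀ {M N} → M ≤ N → ∀ {a} → OldA M a → OldA N a
OldA-mono M≤N {fm f} = OldF-mono M≤N {f}
OldA-mono M≤N {rel _ _ _} (p , q , r) = Old-mono M≤N p , Old-mono M≤N q , Old-mono M≤N r

OldF⇒¬Occ : ∀ {N k} → N ≤ k → ∀ {f} → OldF N f → ¬ OccF k f
OldF⇒¬Occ N≤k k<N here = <-irrefl refl (<-≤-trans k<N N≤k)

OldA⇒¬Occ : ∀ {N k} → N ≤ k → ∀ {a} → OldA N a → ¬ OccA k a
OldA⇒¬Occ N≤k old (inF o) = OldF⇒¬Occ N≤k old o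
OldA⇒¬Occ N≤k (k<N , _) in₁ = <-irrefl refl (<-≤-trans k<N N≤k)
OldA⇒¬Occ N≤k (_ , k<N , _) in₂ = <-irrefl refl (<-≤-trans k<N N≤k)
OldA⇒¬Occ N≤k (_ , _ , k<N) in₃ = <-irrefl refl (<-≤-trans k<N N≤k)

renF : (Label → Label) → LFormula → LFormula
renF τ (x ∶ F) = τ x ∶ F

renA : (Label → Label) → Ant → Ant
renA τ (fm f)      = fm (renF τ f)
renA τ (rel x y z) = rel (τ x) (τ y) (τ z)

-- `τ-old` keeps the labels from `N` on out of a renamed old sequent, and `τ-fresh` lets such a
-- label be its own image when a rule introduces it.
record Naming (N : ℕ) : Set where
  field
    τ       : Label → Label
    τ-ε     : τ ε ≡ ε
    τ-fresh : ∀ {k} → N ≤ k → τ (var k) ≡ var k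
    τ-old   : ∀ {x} → Old N x → Old N (τ x)

  renA-old : ∀ a → OldA N a → OldA N (renA τ a)
  renA-old (fm (_ ∶ _)) = τ-old
  renA-old (rel _ _ _) (p , q , r) = τ-old p , τ-old q , τ-old r

  renF-old : ∀ f → OldF N f → OldF N (renF τ f)
  renF-old (_ ∶ _) = τ-old

  fresh : ∀ {k} → N ≤ k → All (OldA N) Γ → All (OldF N) Δ →
          Fresh k (map (renA τ) Γ) (map (renF τ) Δ)
  fresh N≤k Γ-old Δ-old (inj₁ occ) =
    All.All¬⇒¬Any (All.map⁺ (All.map (λ {a} → OldA⇒¬Occ N≤k ∘ renA-old a) Γ-old)) occ
  fresh N≤k Γ-old Δ-old (inj₂ occ) =
    All.All¬⇒¬Any (All.map⁺ (All.map (λ {f} → OldF⇒¬Occ N≤k ∘ renF-old f) Δ-old)) occ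

widen : ∀ {M N} → M ≤ N → Naming M → Naming N
widen {M} {N} M≤N ν = record
  { τ = τ ; τ-ε = τ-ε ; τ-fresh = τ-fresh ∘ ≤-trans M≤N ; τ-old = λ {x} → old {x} }
  where
  open Naming ν
  old : ∀ {x} → Old N x → Old N (τ x)
  old {ε} _ = subst (Old N) (sym τ-ε) tt
  old {var k} k<N with M ≤? k
  -- Between `M` and `N` the naming is still the identity; below `M` its own bound applies.
  ... | yes M≤k = subst (Old N) (sym (τ-fresh M≤k)) k<N
  ... | no M≰k = Old-mono M≤N (τ-old (≰⇒> M≰k))

-- The substitution is applied after `τ`, so labels that are already identified stay identified.
identify-var : ∀ {N} → Naming N → (b : Label) (k : ℕ) → Old N b → k < N → Naming N
identify-var {N} ν b k b-old k<N = record
  { τ = substL b (var k) ∘ τ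
  ; τ-ε = cong (substL b (var k)) τ-ε
  ; τ-fresh = fr
  ; τ-old = λ o → old (τ-old o) }
  where
  open Naming ν
  fr : ∀ {m} → N ≤ m → substL b (var k) (τ (var m)) ≡ var m
  fr {m} N≤m rewrite τ-fresh N≤m with var m ≟L var k
  ... | yes refl = ⊥-elim (<-irrefl refl (<-≤-trans k<N N≤m))
  ... | no _ = refl
  old : ∀ {x} → Old N x → Old N (substL b (var k) x)
  old {x} o with x ≟L var k
  ... | yes _ = b-old
  ... | no _ = o

-- States, their growth, and single steps.

-- Γₛ and Δₛ are kept under the original labels; the sequent they stand for is their image under τ.
record State : Set where
  field
    N           : ℕ
    naming      : Naming N
    Γₛ           : List Ant
    Δₛ           : List LFormula
    H           : List Signed
  open Naming naming public
  field
    Γ-old       : All (OldA N) Γₛ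
    Δ-old       : All (OldF N) Δₛ
    underivable : ¬ (map (renA τ) Γₛ ⊢ map (renF τ) Δₛ)
    status      : ∀ {s} → s ∈ H → Active Γₛ Δₛ s ⊎ Done τ Γₛ H s

-- Formulas of the sequent may be consumed, so growth concerns only the label bound, the relational
-- atoms, the record `H` and the identifications.
record _⊑_ (S T : State) : Set where
  open State
  field
    N-mono   : N S ≤ N T
    rel-mono : ∀ {x y z} → rel x y z ∈ Γₛ S → rel x y z ∈ Γₛ T
    H-mono   : ∀ {s} → s ∈ H S → s ∈ H T
    τ-mono   : ∀ {x y} → τ S x ≡ τ S y → τ T x ≡ τ T y
open _⊑_

⊑-refl : ∀ {S} → S ⊑ S
⊑-refl = record
  { N-mono = ≤-refl ; rel-mono = λ r → r ; H-mono = λ h → h ; τ-mono = λ t → t }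

⊑-trans : ∀ {S T U} → S ⊑ T → T ⊑ U → S ⊑ U
⊑-trans p q = record
  { N-mono = ≤-trans (N-mono p) (N-mono q)
  ; rel-mono = λ r → rel-mono q (rel-mono p r)
  ; H-mono = λ h → H-mono q (H-mono p h)
  ; τ-mono = λ t → τ-mono q (τ-mono p t) }

module _ (S : State) where
  open State S

  -- The obligations common to all rules. A formula may leave the sequent only if `keep` shows it
  -- done; `after` derives the invariant `status` from this once and for all.
  record Step : Set where
    field
      N′           : ℕ
      N≤N′         : N ≤ N′
      naming′      : Naming N′
      Γ′           : List Ant
      Δ′           : List LFormula
    H′ : List Signed
    H′ = signed Γ′ Δ′ ++ H
    open Naming naming′ public using () renaming (τ to τ′)
    field
      τ-mono′      : ∀ {x y} → τ x ≡ τ y → τ′ x ≡ τ′ y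
      Γ′-old       : All (OldA N′) Γ′
      Δ′-old       : All (OldF N′) Δ′
      underivable′ : ¬ (map (renA τ′) Γ′ ⊢ map (renF τ′) Δ′)
      rel-keep     : ∀ {x y z} → rel x y z ∈ Γₛ → rel x y z ∈ Γ′
      keep         : ∀ s → Active Γₛ Δₛ s → Active Γ′ Δ′ s ⊎ Done τ′ Γ′ H′ s

  module _ (step : Step) where
    open Step step

    after : State
    after = record
      { N = N′ ; naming = naming′ ; Γₛ = Γ′ ; Δₛ = Δ′ ; H = H′ ; Γ-old = Γ′-old ; Δ-old = Δ′-old
      ; underivable = underivable′ ; status = status′ }
      where
      status′ : ∀ {s} → s ∈ H′ → Active Γ′ Δ′ s ⊎ Done τ′ Γ′ H′ s
      status′ {s} h with ∈-++⁻ (signed Γ′ Δ′) h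
      ... | inj₁ new = inj₁ (∈signed⇒Active Γ′ new)
      ... | inj₂ old with status old
      ... | inj₁ act = keep s act
      ... | inj₂ done =
        inj₂ (Done-mono rel-keep (∈-++⁺ʳ (signed Γ′ Δ′)) τ-mono′ s done)

    ⊑-after : S ⊑ after
    ⊑-after = record
      { N-mono = N≤N′ ; rel-mono = rel-keep ; H-mono = ∈-++⁺ʳ (signed Γ′ Δ′)
      ; τ-mono = τ-mono′ }

    active⇒∈H : ∀ {s} → Active Γ′ Δ′ s → s ∈ State.H after
    active⇒∈H act = ∈-++⁺ˡ (Active⇒∈signed Γ′ act)

module _ (S : State) {N′ : ℕ} (N≤N′ : State.N S ≤ N′) (Θ : List Ant) (Ψ : List LFormula)
         (Θ-old : All (OldA N′) Θ) (Ψ-old : All (OldF N′) Ψ) where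
  open State S

  -- For rules that retain their principal parts. `rule` maps derivations of the larger sequent to
  -- derivations of the current one; contraposed, it carries underivability upwards.
  add : (map (renA τ) (Θ ++ Γₛ) ⊢ map (renF τ) (Ψ ++ Δₛ) →
         map (renA τ) Γₛ ⊢ map (renF τ) Δₛ) →
        ∃[ T ] S ⊑ T ×
          (∀ {s} → Active (Θ ++ Γₛ) (Ψ ++ Δₛ) s → s ∈ State.H T) ×
          (∀ {a} → a ∈ Θ ++ Γₛ → a ∈ State.Γₛ T)
  add rule = after S step , ⊑-after S step , active⇒∈H S step , λ r → r
    where
    step : Step S
    step = record
      { N′ = N′ ; N≤N′ = N≤N′ ; naming′ = widen N≤N′ naming
      ; Γ′ = Θ ++ Γₛ ; Δ′ = Ψ ++ Δₛ ; τ-mono′ = λ t → t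
      ; Γ′-old = All.++⁺ Θ-old (All.map (λ {a} → OldA-mono N≤N′ {a}) Γ-old)
      ; Δ′-old = All.++⁺ Ψ-old (All.map (λ {f} → OldF-mono N≤N′ {f}) Δ-old)
      ; underivable′ = underivable ∘ rule
      ; rel-keep = ∈-++⁺ʳ Θ
      ; keep = λ { (left , _) h → inj₁ (∈-++⁺ʳ Θ h) ; (right , _) h → inj₁ (∈-++⁺ʳ Ψ h) } }

  -- For rules that drop their principal formula. `done` is asked for every record covering the new
  -- sequent, because it is needed while the step with its record is still being built.
  consumeˡ : ∀ {f} → Γₛ ↭ fm f ∷ Γ →
             (map (renA τ) (Θ ++ Γ) ⊢ map (renF τ) (Ψ ++ Δₛ) →
              map (renA τ) (fm f ∷ Γ) ⊢ map (renF τ) Δₛ) →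
             (∀ {H′} → (∀ {s} → Active (Θ ++ Γ) (Ψ ++ Δₛ) s → s ∈ H′) →
              Done τ (Θ ++ Γ) H′ (left , f)) →
             ∃[ T ] S ⊑ T × Done (State.τ T) (State.Γₛ T) (State.H T) (left , f)
  consumeˡ {Γ} {f} p rule done =
    after S step , ⊑-after S step , done (active⇒∈H S step)
    where
    step : Step S
    step = record
      { N′ = N′ ; N≤N′ = N≤N′ ; naming′ = widen N≤N′ naming
      ; Γ′ = Θ ++ Γ ; Δ′ = Ψ ++ Δₛ ; τ-mono′ = λ t → t
      ; Γ′-old = All.++⁺ Θ-old
          (All.map (λ {a} → OldA-mono N≤N′ {a}) (All.tail (All-resp-↭ p Γ-old)))
      ; Δ′-old = All.++⁺ Ψ-old (All.map (λ {f} → OldF-mono N≤N′ {f}) Δ-old)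
      ; underivable′ = underivable ∘ onΓ (↭-map⁺ _ (↭-sym p)) ∘ rule
      ; rel-keep = λ r → case ∈-resp-↭ p r of λ { (there r′) → ∈-++⁺ʳ Θ r′ }
      ; keep = λ { (left , _) h → case ∈-resp-↭ p h of λ
                     { (here refl) → inj₂ (done (∈-++⁺ˡ ∘ Active⇒∈signed (Θ ++ Γ)))
                     ; (there h′) → inj₁ (∈-++⁺ʳ Θ h′) }
                 ; (right , _) h → inj₁ (∈-++⁺ʳ Ψ h) } }

  consumeʳ : ∀ {f} → Δₛ ↭ f ∷ Δ →
             (map (renA τ) (Θ ++ Γₛ) ⊢ map (renF τ) (Ψ ++ Δ) →
              map (renA τ) Γₛ ⊢ map (renF τ) (f ∷ Δ)) →
             (∀ {H′} → (∀ {s} → Active (Θ ++ Γₛ) (Ψ ++ Δ) s → s ∈ H′) →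
              Done τ (Θ ++ Γₛ) H′ (right , f)) →
             ∃[ T ] S ⊑ T × Done (State.τ T) (State.Γₛ T) (State.H T) (right , f)
  consumeʳ {Δ} {f} p rule done =
    after S step , ⊑-after S step , done (active⇒∈H S step)
    where
    step : Step S
    step = record
      { N′ = N′ ; N≤N′ = N≤N′ ; naming′ = widen N≤N′ naming
      ; Γ′ = Θ ++ Γₛ ; Δ′ = Ψ ++ Δ ; τ-mono′ = λ t → t
      ; Γ′-old = All.++⁺ Θ-old (All.map (λ {a} → OldA-mono N≤N′ {a}) Γ-old)
      ; Δ′-old = All.++⁺ Ψ-old
          (All.map (λ {f} → OldF-mono N≤N′ {f}) (All.tail (All-resp-↭ p Δ-old)))
      ; underivable′ = underivable ∘ perm ↭-refl (↭-map⁺ _ (↭-sym p)) ∘ rule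
      ; rel-keep = ∈-++⁺ʳ Θ
      ; keep = λ { (left , _) h → inj₁ (∈-++⁺ʳ Θ h)
                 ; (right , _) h → case ∈-resp-↭ p h of λ
                     { (here refl) → inj₂ (done (∈-++⁺ˡ ∘ Active⇒∈signed (Θ ++ Γₛ)))
                     ; (there h′) → inj₁ (∈-++⁺ʳ Ψ h′) } } }

module Merge (S : State) (b : Label) (k : ℕ) where
  open State S

  σ : Label → Label
  σ = substL b (var k) ∘ τ

  σA : map (renA σ) Γ ≡ map (renA τ) Γ [ b / var k ]A
  σA {Γ} = trans (map-cong (λ { (fm _) → refl ; (rel _ _ _) → refl }) Γ) (map-∘ Γ)

  σF : map (renF σ) Δ ≡ map (renF τ) Δ [ b / var k ]F
  σF {Δ} = trans (map-cong (λ _ → refl) Δ) (map-∘ Δ)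

  -- Serves `⊤*L`, `Eq₁` and `Eq₂` alike: stored labels stay untouched and only the naming changes.
  -- `Γ` may differ from `Γₛ` because `⊤*L` drops its principal formula, which is then done under
  -- `σ`.
  merge : Old N b → k < N → All (OldA N) Γ →
          (map (renA τ) Γ [ b / var k ]A ⊢ map (renF τ) Δₛ [ b / var k ]F →
           map (renA τ) Γₛ ⊢ map (renF τ) Δₛ) →
          (∀ {x y z} → rel x y z ∈ Γₛ → rel x y z ∈ Γ) →
          (∀ f → fm f ∈ Γₛ → fm f ∈ Γ ⊎ (∀ H′ → Done σ Γ H′ (left , f))) →
          Step S
  merge {Γ} b-old k<N old rule rels fms = record
    { N′ = N ; N≤N′ = ≤-refl ; naming′ = identify-var naming b k b-old k<N
    ; Γ′ = Γ ; Δ′ = Δₛ ; τ-mono′ = cong (substL b (var k))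
    ; Γ′-old = old ; Δ′-old = Δ-old
    ; underivable′ = underivable ∘ rule ∘ subst₂ _⊢_ σA σF
    ; rel-keep = rels
    ; keep = λ { (left , f) h → Sum.map₂ (λ d → d _) (fms f h) ; (right , _) → inj₁ } }

-- Goals: rule instances waiting to be applied.

data Goal : Set where
  decompose    : Signed → Goal
  combine      : Signed → Ant → Goal
  reassociate  : Ant → Ant → Goal
  commute      : Ant → Goal
  cancel-unit  : Ant → Goal
  add-unit     : Label → Goal

module _ (S : State) where
  open State S

  -- Atoms and formulas are stored under their original labels, so labels that a rule wants equal
  -- need only agree after renaming. A goal itself mentions no state and can be ready at one stage
  -- and met at a later one.
  data Ready : Goal → Set where
    decompose   : ∀ {s} → s ∈ H → Ready (decompose s)
    combine-*   : (right , z ∶ (F `* G)) ∈ H → rel x y w ∈ Γₛ → τ w ≡ τ z →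
                  Ready (combine (right , z ∶ (F `* G)) (rel x y w))
    combine--*  : (left , y ∶ (F `-* G)) ∈ H → rel x w z ∈ Γₛ → τ w ≡ τ y →
                  Ready (combine (left , y ∶ (F `-* G)) (rel x w z))
    reassociate : rel x y z ∈ Γₛ → rel u v w ∈ Γₛ → τ w ≡ τ x →
                  Ready (reassociate (rel x y z) (rel u v w))
    commute     : rel x y z ∈ Γₛ → Ready (commute (rel x y z))
    cancel-unit : rel x y z ∈ Γₛ → τ x ≡ τ ε → Ready (cancel-unit (rel x y z))
    add-unit    : Old N x → Ready (add-unit x)

  data Met : Goal → Set where
    decompose   : ∀ {s} → Done τ Γₛ H s ⊎ Inert s → Met (decompose s)
    combine-*   : (right , x ∶ F) ∈ H ⊎ (right , y ∶ G) ∈ H →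
                  Met (combine (right , z ∶ (F `* G)) (rel x y w))
    combine--*  : (right , x ∶ F) ∈ H ⊎ (left , z ∶ G) ∈ H →
                  Met (combine (left , y ∶ (F `-* G)) (rel x w z))
    reassociate : ∀ {w′} → rel u w′ z ∈ Γₛ → rel y v w′ ∈ Γₛ →
                  Met (reassociate (rel x y z) (rel u v w))
    commute     : rel y x z ∈ Γₛ → Met (commute (rel x y z))
    cancel-unit : τ y ≡ τ z → Met (cancel-unit (rel x y z))
    add-unit    : rel x ε x ∈ Γₛ → Met (add-unit x)

-- Readiness survives while other goals are served; together with `Met-mono` this makes a single
-- pass over a list of goals sufficient.
Ready-mono : ∀ {S T g} → S ⊑ T → Ready S g → Ready T g
Ready-mono p (decompose h)       = decompose (H-mono p h)
Ready-mono p (combine-* h r t)   = combine-* (H-mono p h) (rel-mono p r) (τ-mono p t)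
Ready-mono p (combine--* h r t)  = combine--* (H-mono p h) (rel-mono p r) (τ-mono p t)
Ready-mono p (reassociate r q t) = reassociate (rel-mono p r) (rel-mono p q) (τ-mono p t)
Ready-mono p (commute r)         = commute (rel-mono p r)
Ready-mono p (cancel-unit r t)   = cancel-unit (rel-mono p r) (τ-mono p t)
Ready-mono p (add-unit {x} o)    = add-unit (Old-mono (N-mono p) {x} o)

Met-mono : ∀ {S T g} → S ⊑ T → Met S g → Met T g
Met-mono p (decompose {s} d)   =
  decompose (Sum.map₁ (Done-mono (rel-mono p) (H-mono p) (τ-mono p) s) d)
Met-mono p (combine-* d)       = combine-* (Sum.map (H-mono p) (H-mono p) d)
Met-mono p (combine--* d)      = combine--* (Sum.map (H-mono p) (H-mono p) d)
Met-mono p (reassociate r q)   = reassociate (rel-mono p r) (rel-mono p q)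
Met-mono p (commute r)         = commute (rel-mono p r)
Met-mono p (cancel-unit t)     = cancel-unit (τ-mono p t)
Met-mono p (add-unit r)        = add-unit (rel-mono p r)

-- Meeting a single goal.

module _ (em : ExcludedMiddle 0ℓ) (S : State) where
  open State S

  decomposeˡ : ∀ f → fm f ∈ Γₛ →
               (∃[ T ] S ⊑ T × Done (State.τ T) (State.Γₛ T) (State.H T) (left , f)) ⊎
               Inert (left , f)
  decomposeˡ (x ∶ atom p)   h = inj₂ tt
  decomposeˡ (x ∶ `⊤)       h = inj₂ tt
  decomposeˡ (x ∶ `⊥)       h = inj₂ tt
  decomposeˡ (x ∶ (F `-* G)) h = inj₂ tt
  decomposeˡ (x ∶ (F `∧ G)) h = inj₁
    (consumeˡ S ≤-refl (fm (x ∶ F) ∷ fm (x ∶ G) ∷ []) [] (x-old ∷ x-old ∷ []) []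
      (proj₂ (pick h)) ∧L (λ new → new (here refl) , new (there (here refl))))
    where x-old = All.lookup Γ-old h
  decomposeˡ (x ∶ (F `→ G)) h with pick h
  -- If the first premise is derivable, the rule turns derivations of the second into derivations of
  -- the conclusion, so the second is underivable. Otherwise the first premise is the one to
  -- continue with.
  ... | Γ₁ , p with em {map (renA τ) Γ₁ ⊢ (τ x ∶ F) ∷ map (renF τ) Δₛ}
  ... | yes d = inj₁
    (consumeˡ S ≤-refl (fm (x ∶ G) ∷ []) [] (All.lookup Γ-old h ∷ []) []
      p (→L d) (λ new → inj₂ (new (here refl))))
  ... | no ¬d = inj₁
    (consumeˡ S ≤-refl [] ((x ∶ F) ∷ []) [] (All.lookup Γ-old h ∷ [])
      p (⊥-elim ∘ ¬d) (λ new → inj₁ (new (here refl))))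
  decomposeˡ (x ∶ `⊤*) h with τ x in eq
  -- `⊤*L` needs a variable; at `ε` the required identification already holds and the formula can
  -- stay.
  ... | ε = inj₁ (S , ⊑-refl , trans eq (sym τ-ε))
  ... | var k with pick h
  ... | Γ₁ , p = inj₁ (after S step , ⊑-after S step , σx≡σε)
    where
    open Merge S ε k
    σx≡σε : σ x ≡ σ ε
    σx≡σε = trans (cong (substL ε (var k)) eq)
              (trans (substL-old ε (var k)) (sym (cong (substL ε (var k)) τ-ε)))
    step : Step S
    step = merge tt (subst (Old N) eq (τ-old (All.lookup Γ-old h)))
      (All.tail (All-resp-↭ p Γ-old))
      (λ d → onΓ (↭-map⁺ _ (↭-sym p))
        (subst (λ l → fm (l ∶ `⊤*) ∷ map (renA τ) Γ₁ ⊢ map (renF τ) Δₛ) (sym eq) (⊤*L k d)))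
      (λ r → case ∈-resp-↭ p r of λ { (there r′) → r′ })
      (λ f h′ → case ∈-resp-↭ p h′ of λ
        { (here refl) → inj₂ (λ _ → σx≡σε) ; (there h″) → inj₁ h″ })
  decomposeˡ (z ∶ (F `* G)) h with pick h
  ... | Γ₁ , p = inj₁
    -- The eigenvariables are `N` and `suc N`, so the bound rises to `2 + N`.
    (consumeˡ S (m≤n+m N 2)
      (rel a b z ∷ fm (a ∶ F) ∷ fm (b ∶ G) ∷ []) []
      ((a-old , b-old , Old-mono (m≤n+m N 2) {z} (All.lookup Γ-old h)) ∷ a-old ∷ b-old ∷ [])
      [] p
      (*L-≡ (τ-fresh ≤-refl) (τ-fresh (n≤1+n N)) (1+n≢n ∘ sym)
        (fresh ≤-refl (All-resp-↭ p Γ-old) Δ-old)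
        (fresh (n≤1+n N) (All-resp-↭ p Γ-old) Δ-old))
      (λ new → a , b , here refl , new (there (here refl)) , new (there (there (here refl)))))
    where
    a b : Label
    a = var N
    b = var (suc N)
    a-old : N < 2 + N
    a-old = n≤1+n (suc N)
    b-old : suc N < 2 + N
    b-old = ≤-refl

  decomposeʳ : ∀ f → f ∈ Δₛ →
               (∃[ T ] S ⊑ T × Done (State.τ T) (State.Γₛ T) (State.H T) (right , f)) ⊎
               Inert (right , f)
  decomposeʳ (x ∶ atom p)   h = inj₂ tt
  decomposeʳ (x ∶ `⊤)       h = inj₂ tt
  decomposeʳ (x ∶ `⊥)       h = inj₂ tt
  decomposeʳ (x ∶ `⊤*)      h = inj₂ tt
  decomposeʳ (x ∶ (F `* G)) h = inj₂ tt
  decomposeʳ (x ∶ (F `∧ G)) h with pick h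
  ... | Δ₁ , p with em {map (renA τ) Γₛ ⊢ (τ x ∶ F) ∷ map (renF τ) Δ₁}
  ... | yes d = inj₁
    (consumeʳ S ≤-refl [] ((x ∶ G) ∷ []) [] (All.lookup Δ-old h ∷ [])
      p (∧R d) (λ new → inj₂ (new (here refl))))
  ... | no ¬d = inj₁
    (consumeʳ S ≤-refl [] ((x ∶ F) ∷ []) [] (All.lookup Δ-old h ∷ [])
      p (⊥-elim ∘ ¬d) (λ new → inj₁ (new (here refl))))
  decomposeʳ (x ∶ (F `→ G)) h = inj₁
    (consumeʳ S ≤-refl (fm (x ∶ F) ∷ []) ((x ∶ G) ∷ []) (x-old ∷ []) (x-old ∷ [])
      (proj₂ (pick h)) →R (λ new → new (here refl) , new (here refl)))
    where x-old = All.lookup Δ-old h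
  decomposeʳ (y ∶ (F `-* G)) h with pick h
  ... | Δ₁ , p = inj₁
    (consumeʳ S (m≤n+m N 2)
      (rel a y c ∷ fm (a ∶ F) ∷ []) ((c ∶ G) ∷ [])
      ((a-old , Old-mono (m≤n+m N 2) {y} (All.lookup Δ-old h) , c-old) ∷ a-old ∷ [])
      (c-old ∷ []) p
      (-*R-≡ (τ-fresh ≤-refl) (τ-fresh (n≤1+n N)) (1+n≢n ∘ sym)
        (fresh ≤-refl Γ-old (All-resp-↭ p Δ-old))
        (fresh (n≤1+n N) Γ-old (All-resp-↭ p Δ-old)))
      (λ new → a , c , here refl , new (there (here refl)) , new (here refl)))
    where
    a c : Label
    a = var N
    c = var (suc N)
    a-old : N < 2 + N
    a-old = n≤1+n (suc N)
    c-old : suc N < 2 + N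
    c-old = ≤-refl

  solve : ∀ {g} → Ready S g → ∃[ T ] S ⊑ T × Met T g
  solve (decompose {s} h) with status h
  ... | inj₂ d = S , ⊑-refl , decompose (inj₁ d)
  solve (decompose {left , f} h) | inj₁ act with decomposeˡ f act
  ... | inj₁ (T , p , d) = T , p , decompose (inj₁ d)
  ... | inj₂ i = S , ⊑-refl , decompose (inj₂ i)
  solve (decompose {right , f} h) | inj₁ act with decomposeʳ f act
  ... | inj₁ (T , p , d) = T , p , decompose (inj₁ d)
  ... | inj₂ i = S , ⊑-refl , decompose (inj₂ i)
  solve (combine-* {z} {F} {G} {x} {y} {w} h r t) with status h
  -- `Done` is empty for `*` on the right, so the formula is still active.
  ... | inj₁ act with All.lookup Γ-old r | em {map (renA τ) Γₛ ⊢ (τ x ∶ F) ∷ map (renF τ) Δₛ}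
  ... | x-old , _ | no ¬d =
    let T , p , new , _ = add S ≤-refl [] ((x ∶ F) ∷ []) [] (x-old ∷ []) (⊥-elim ∘ ¬d)
    in T , p , combine-* (inj₁ (new (here refl)))
  ... | _ , y-old , _ | yes d =
    let T , p , new , _ = add S ≤-refl [] ((y ∶ G) ∷ []) [] (y-old ∷ [])
          (*R-∈ (rel-≡ refl refl t (∈-map⁺ (renA τ) r)) (∈-map⁺ (renF τ) act) d)
    in T , p , combine-* (inj₂ (new (here refl)))
  solve (combine--* {y} {F} {G} {x} {w} {z} h r t) with status h
  ... | inj₁ act with All.lookup Γ-old r | em {map (renA τ) Γₛ ⊢ (τ x ∶ F) ∷ map (renF τ) Δₛ}
  ... | x-old , _ | no ¬d =
    let T , p , new , _ = add S ≤-refl [] ((x ∶ F) ∷ []) [] (x-old ∷ []) (⊥-elim ∘ ¬d)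
    in T , p , combine--* (inj₁ (new (here refl)))
  ... | _ , _ , z-old | yes d =
    let T , p , new , _ = add S ≤-refl (fm (z ∶ G) ∷ []) [] (z-old ∷ []) []
          (-*L-∈ (rel-≡ refl t refl (∈-map⁺ (renA τ) r)) (∈-map⁺ (renA τ) act) d)
    in T , p , combine--* (inj₂ (new (here refl)))
  solve (reassociate {x} {y} {z} {u} {v} {w} r q t) with All.lookup Γ-old r | All.lookup Γ-old q
  ... | _ , y-old , z-old | u-old , v-old , _ =
    let N≤ = n≤1+n N
        T , p , _ , new = add S N≤ (rel u (var N) z ∷ rel y v (var N) ∷ []) []
          ((Old-mono N≤ {u} u-old , ≤-refl , Old-mono N≤ {z} z-old) ∷
           (Old-mono N≤ {y} y-old , Old-mono N≤ {v} v-old , ≤-refl) ∷ []) []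
          (A-∈ (τ-fresh ≤-refl) (fresh ≤-refl Γ-old Δ-old) (∈-map⁺ (renA τ) r)
            (rel-≡ refl refl t (∈-map⁺ (renA τ) q)))
    in T , p , reassociate (new (here refl)) (new (there (here refl)))
  solve (commute {x} {y} {z} r) =
    let x-old , y-old , z-old = All.lookup Γ-old r
        T , p , _ , new = add S ≤-refl (rel y x z ∷ []) [] ((y-old , x-old , z-old) ∷ []) []
          (E-∈ (∈-map⁺ (renA τ) r))
    in T , p , commute (new (here refl))
  solve (add-unit {x} x-old) =
    let T , p , _ , new = add S ≤-refl (rel x ε x ∷ []) [] ((x-old , tt , x-old) ∷ []) []
          (U-≡ τ-ε)
    in T , p , add-unit (new (here refl))
  -- After renaming, the atom is `rel ε (τ y) (τ z)`. A variable in the middle is eliminated by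
  -- `Eq₁`, failing that a variable on the right by `Eq₂`; if both are `ε`, nothing remains to be
  -- done.
  solve (cancel-unit {x} {y} {z} r t) = cases (τ y) (τ z) refl refl
    where
    y-old = proj₁ (proj₂ (All.lookup Γ-old r))
    z-old = proj₂ (proj₂ (All.lookup Γ-old r))
    renamed : ∀ {a b} → τ y ≡ a → τ z ≡ b → rel ε a b ∈ map (renA τ) Γₛ
    renamed p q = rel-≡ (trans t τ-ε) p q (∈-map⁺ (renA τ) r)
    cases : ∀ a b → τ y ≡ a → τ z ≡ b → ∃[ T ] S ⊑ T × Met T (cancel-unit (rel x y z))
    cases ε ε p q = S , ⊑-refl , cancel-unit (trans p (sym q))
    cases (var k) b p q = after S step , ⊑-after S step , cancel-unit
      (trans (cong (substL b (var k)) p)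
        (trans (trans (substL-old b (var k)) (sym (substL-new b (var k))))
          (cong (substL b (var k)) (sym q))))
      where
      open Merge S b k
      step : Step S
      step = merge (subst (Old N) q (τ-old z-old)) (subst (Old N) p (τ-old y-old)) Γ-old
        (Eq₁-∈ (renamed p q)) (λ r → r) (λ _ → inj₁)
    cases ε (var k) p q = after S step , ⊑-after S step , cancel-unit
      (trans (cong (substL ε (var k)) p)
        (sym (trans (cong (substL ε (var k)) q) (substL-old ε (var k)))))
      where
      open Merge S ε k
      step : Step S
      step = merge tt (subst (Old N) q (τ-old z-old)) Γ-old
        (Eq₂-∈ (renamed p q)) (λ r → r) (λ _ → inj₁)

-- Finitely many candidate goals per state.

-- Only completeness of the list matters: it also holds goals that are not ready, such as `combine`
-- with a formula in place of an atom, and `sweep` passes over those.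
goals : State → List Goal
goals S = map decompose H ++ cartesianProductWith combine H Γₛ ++
  cartesianProductWith reassociate Γₛ Γₛ ++ map commute Γₛ ++ map cancel-unit Γₛ ++
  map add-unit (ε ∷ map var (upTo N))
  where open State S

Ready⇒∈goals : ∀ S {g} → Ready S g → g ∈ goals S
Ready⇒∈goals S = λ where
    (decompose h)       → ∈-++⁺ˡ (∈-map⁺ _ h)
    (combine-* h r _)   → ∈-++⁺ʳ gs₁ (∈-++⁺ˡ (∈-cartesianProductWith⁺ _ h r))
    (combine--* h r _)  → ∈-++⁺ʳ gs₁ (∈-++⁺ˡ (∈-cartesianProductWith⁺ _ h r))
    (reassociate r q _) →
      ∈-++⁺ʳ gs₁ (∈-++⁺ʳ gs₂ (∈-++⁺ˡ (∈-cartesianProductWith⁺ _ r q)))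
    (commute r)         → ∈-++⁺ʳ gs₁ (∈-++⁺ʳ gs₂ (∈-++⁺ʳ gs₃ (∈-++⁺ˡ (∈-map⁺ _ r))))
    (cancel-unit r _)   →
      ∈-++⁺ʳ gs₁ (∈-++⁺ʳ gs₂ (∈-++⁺ʳ gs₃ (∈-++⁺ʳ gs₄ (∈-++⁺ˡ (∈-map⁺ _ r)))))
    (add-unit {x} x-old) →
      ∈-++⁺ʳ gs₁ (∈-++⁺ʳ gs₂ (∈-++⁺ʳ gs₃ (∈-++⁺ʳ gs₄ (∈-++⁺ʳ gs₅ (∈-map⁺ _ (label x x-old))))))
  where
  open State S
  gs₁ gs₂ gs₃ gs₄ gs₅ : List Goal
  gs₁ = map decompose H
  gs₂ = cartesianProductWith combine H Γₛ
  gs₃ = cartesianProductWith reassociate Γₛ Γₛ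
  gs₄ = map commute Γₛ
  gs₅ = map cancel-unit Γₛ
  label : ∀ x → Old N x → x ∈ ε ∷ map var (upTo N)
  label ε _ = here refl
  label (var k) k<N = there (∈-map⁺ var (∈-upTo⁺ k<N))

-- Quotient of the labels by least representatives.

module Representatives (em : ExcludedMiddle 0ℓ) (_~_ : Label → Label → Set)
  (~-refl : ∀ {x} → x ~ x) (~-sym : ∀ {x y} → x ~ y → y ~ x)
  (~-trans : ∀ {x y z} → x ~ y → y ~ z → x ~ z) where

  code : Label → ℕ
  code ε       = zero
  code (var k) = suc k

  decode : ℕ → Label
  decode zero    = ε
  decode (suc k) = var k

  decode∘code : ∀ x → decode (code x) ≡ x
  decode∘code ε       = refl
  decode∘code (var _) = refl

  abstract
    least : (P : ℕ → Set) → ∃ P → ∃[ n ] P n × (∀ m → P m → n ≤ m)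
    least P (n , Pn) = <-rec (λ n → P n → ∃[ n ] P n × (∀ m → P m → n ≤ m)) descend n Pn
      where
      descend : ∀ n → (∀ {m} → m < n → P m → ∃[ n ] P n × (∀ m → P m → n ≤ m)) →
                P n → ∃[ n ] P n × (∀ m → P m → n ≤ m)
      descend n rec Pn with em {∃[ m ] m < n × P m}
      ... | yes (m , m<n , Pm) = rec m<n Pm
      ... | no none = n , Pn , λ m Pm → ≮⇒≥ (λ m<n → none (m , m<n , Pm))

    minimal : ∀ x → ∃[ n ] (x ~ decode n) × (∀ m → x ~ decode m → n ≤ m)
    minimal x = least (λ n → x ~ decode n)
      (code x , subst (x ~_) (sym (decode∘code x)) ~-refl)

    rep : Label → Label
    rep x = decode (proj₁ (minimal x))

    ~-rep : ∀ x → x ~ rep x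
    ~-rep x = proj₁ (proj₂ (minimal x))

    -- Equivalent labels are equivalent to the same codes, so each of the two minima bounds the
    -- other.
    rep-cong : x ~ y → rep x ≡ rep y
    rep-cong {x} {y} x~y = cong decode (≤-antisym
      (proj₂ (proj₂ (minimal x)) _ (~-trans x~y (~-rep y)))
      (proj₂ (proj₂ (minimal y)) _ (~-trans (~-sym x~y) (~-rep x))))

  -- Frames demand propositional equality at the unit, hence canonical labels in place of
  -- equivalence classes. Decidable equality of labels makes the fixed-point proof unique, so a
  -- class is determined by its label.
  Class : Set
  Class = ∃[ x ] rep x ≡ x

  abstract
    [_] : Label → Class
    [ x ] = rep x , rep-cong (~-sym (~-rep x))

    Class-≡ : {a b : Class} → proj₁ a ≡ proj₁ b → a ≡ b
    Class-≡ {x , p} {.x , q} refl = cong (x ,_) (Decidable⇒UIP.≡-irrelevant _≟L_ p q)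

    []-cong : x ~ y → [ x ] ≡ [ y ]
    []-cong x~y = Class-≡ (rep-cong x~y)

    []-effective : [ x ] ≡ [ y ] → x ~ y
    []-effective {x} {y} eq =
      ~-trans (~-rep x) (subst (_~ y) (sym (cong proj₁ eq)) (~-sym (~-rep y)))

    []-proj₁ : (a : Class) → [ proj₁ a ] ≡ a
    []-proj₁ (x , p) = Class-≡ p

-- Forcing for the formulae of the calculus.

module _ (𝓜 : Model) where
  open Model 𝓜

  _⊨_ : Carrier → CFormula → Set
  m ⊨ atom p   = val p m
  m ⊨ `⊤       = ⊤
  m ⊨ `⊥       = ⊥
  m ⊨ (F `∧ G) = (m ⊨ F) × (m ⊨ G)
  m ⊨ (F `→ G) = m ⊨ F → m ⊨ G
  m ⊨ `⊤*      = m ≡ e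
  m ⊨ (F `* G) = ∃[ a ] ∃[ b ] (R a b m × a ⊨ F × b ⊨ G)
  m ⊨ (F `-* G) = ∀ a b → R m a b → a ⊨ F → b ⊨ G

  module _ (em : ExcludedMiddle 0ℓ) where
    -- The directions call each other because negation, implication and `-*` reverse them. Excluded
    -- middle enters only in recovering a disjunction from its De Morgan form.
    ⊩⇒⊨ : ∀ B {m} → _⊩_ 𝓜 m B → m ⊨ unfoldAbbr B
    ⊨⇒⊩ : ∀ B {m} → m ⊨ unfoldAbbr B → _⊩_ 𝓜 m B

    ⊩⇒⊨ (atom p) h = h
    ⊩⇒⊨ `⊤ h = h
    ⊩⇒⊨ (`¬ B) h = h ∘ ⊨⇒⊩ B
    ⊩⇒⊨ (B `∨ C) (inj₁ h) (¬B , _) = ¬B (⊩⇒⊨ B h)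
    ⊩⇒⊨ (B `∨ C) (inj₂ h) (_ , ¬C) = ¬C (⊩⇒⊨ C h)
    ⊩⇒⊨ (B `∧ C) (p , q) = ⊩⇒⊨ B p , ⊩⇒⊨ C q
    ⊩⇒⊨ (B `→ C) h = ⊩⇒⊨ C ∘ h ∘ ⊨⇒⊩ B
    ⊩⇒⊨ `⊤* h = h
    ⊩⇒⊨ (B `* C) (a , b , r , p , q) = a , b , r , ⊩⇒⊨ B p , ⊩⇒⊨ C q
    ⊩⇒⊨ (B `-* C) h a b r p = ⊩⇒⊨ C (h a b r (⊨⇒⊩ B p))

    ⊨⇒⊩ (atom p) h = h
    ⊨⇒⊩ `⊤ h = h
    ⊨⇒⊩ (`¬ B) h = h ∘ ⊩⇒⊨ B
    ⊨⇒⊩ (B `∨ C) {m} h with em {_⊩_ 𝓜 m B} | em {_⊩_ 𝓜 m C}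
    ... | yes p | _     = inj₁ p
    ... | no _  | yes q = inj₂ q
    ... | no ¬p | no ¬q = ⊥-elim (h (¬p ∘ ⊨⇒⊩ B , ¬q ∘ ⊨⇒⊩ C))
    ⊨⇒⊩ (B `∧ C) (p , q) = ⊨⇒⊩ B p , ⊨⇒⊩ C q
    ⊨⇒⊩ (B `→ C) h = ⊨⇒⊩ C ∘ h ∘ ⊩⇒⊨ B
    ⊨⇒⊩ `⊤* h = h
    ⊨⇒⊩ (B `* C) (a , b , r , p , q) = a , b , r , ⊨⇒⊩ B p , ⊨⇒⊩ C q
    ⊨⇒⊩ (B `-* C) h a b r p = ⊨⇒⊩ C (h a b r (⊩⇒⊨ B p))

-- The fair chain of stages and its limit frame.

module Countermodel (em : ExcludedMiddle 0ℓ) (S₀ : State) where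
  open State

  abstract
    sweep : ∀ gs S → ∃[ T ] S ⊑ T × (∀ {g} → g ∈ gs → Ready S g → Met T g)
    sweep [] S = S , ⊑-refl , λ ()
    sweep (g ∷ gs) S with em {Ready S g}
    ... | no ¬r =
      let T , p , met = sweep gs S
      in T , p , λ { (here refl) r → ⊥-elim (¬r r) ; (there g∈gs) r → met g∈gs r }
    ... | yes r =
      let S′ , p , m = solve em S r
          T , q , met = sweep gs S′
      in T , ⊑-trans p q ,
         λ { (here refl) _ → Met-mono q m ; (there g∈gs) r → met g∈gs (Ready-mono p r) }

    next : ∀ S → ∃[ T ] S ⊑ T × (∀ {g} → Ready S g → Met T g) × N S < N T
    next S =
      -- Adding nothing still raises the label bound, so every variable eventually becomes old and
      -- receives its unit atom.
      let S′ , p , _ = add S (n≤1+n (N S)) [] [] [] [] (λ d → d)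
          T , q , met = sweep (goals S) S′
      in T , ⊑-trans p q , (λ r → met (Ready⇒∈goals S r) (Ready-mono p r)) , N-mono q

  stage : ℕ → State
  stage zero    = S₀
  stage (suc n) = proj₁ (next (stage n))

  stage-+ : ∀ k {m} → stage m ⊑ stage (k + m)
  stage-+ zero = ⊑-refl
  stage-+ (suc k) {m} = ⊑-trans (stage-+ k) (proj₁ (proj₂ (next (stage (k + m)))))

  stage-mono : ∀ {m n} → m ≤ n → stage m ⊑ stage n
  stage-mono {m} {n} m≤n =
    subst (λ k → stage m ⊑ stage k) (m∸n+n≡m m≤n) (stage-+ (n ∸ m))

  stage-⊔₁ : ∀ m n o → stage m ⊑ stage (m ⊔ n ⊔ o)
  stage-⊔₁ m n o = stage-mono (≤-trans (m≤m⊔n m n) (m≤m⊔n (m ⊔ n) o))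

  stage-⊔₂ : ∀ m n o → stage n ⊑ stage (m ⊔ n ⊔ o)
  stage-⊔₂ m n o = stage-mono (≤-trans (m≤n⊔m m n) (m≤m⊔n (m ⊔ n) o))

  stage-⊔₃ : ∀ m n o → stage o ⊑ stage (m ⊔ n ⊔ o)
  stage-⊔₃ m n o = stage-mono (m≤n⊔m (m ⊔ n) o)

  progress : ∀ {m g} → Ready (stage m) g → Met (stage (suc m)) g
  progress {m} = proj₁ (proj₂ (proj₂ (next (stage m))))

  stage-N : ∀ m → m ≤ N (stage m)
  stage-N zero = z≤n
  stage-N (suc m) = ≤-trans (s≤s (stage-N m)) (proj₂ (proj₂ (proj₂ (next (stage m)))))

  Old-eventually : ∀ x → ∃[ m ] Old (N (stage m)) x
  Old-eventually ε = zero , tt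
  Old-eventually (var k) = suc k , stage-N (suc k)

  _∼_ : Label → Label → Set
  x ∼ y = ∃[ m ] τ (stage m) x ≡ τ (stage m) y

  -- Identifications persist, so both hold at the later of the two stages.
  ∼-trans : x ∼ y → y ∼ z → x ∼ z
  ∼-trans (m , p) (n , q) =
    m ⊔ n , trans (τ-mono (stage-mono (m≤m⊔n m n)) p) (τ-mono (stage-mono (m≤n⊔m m n)) q)

  open Representatives em _∼_ (zero , refl) (λ (m , p) → m , sym p) ∼-trans public

  Rel : Label → Label → Label → Set
  Rel x y z = ∃[ m ] rel x y z ∈ Γₛ (stage m)

  Rel-comm : Rel x y z → Rel y x z
  Rel-comm (m , r) with progress {m} (commute r)
  ... | commute r′ = suc m , r′

  Rel-unit : ∀ x → Rel ε x x
  Rel-unit x with Old-eventually x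
  ... | m , old with progress {m} (add-unit {x = x} old)
  ... | add-unit r = Rel-comm (suc m , r)

  Rel-cancel : Rel x y z → x ∼ ε → y ∼ z
  Rel-cancel (m , r) (n , t)
    with progress {m ⊔ n} (cancel-unit (rel-mono (stage-mono (m≤m⊔n m n)) r)
                                       (τ-mono (stage-mono (m≤n⊔m m n)) t))
  ... | cancel-unit t′ = suc (m ⊔ n) , t′

  Rel-assoc : Rel x y z → Rel u v w → w ∼ x → ∃[ l ] Rel u l z × Rel y v l
  Rel-assoc (m , r) (n , q) (o , t)
    -- At this stage both atoms and the identification are present together; the next stage has met
    -- the goal.
    with progress {m ⊔ n ⊔ o}
      (reassociate (rel-mono (stage-⊔₁ m n o) r)
                   (rel-mono (stage-⊔₂ m n o) q)
                   (τ-mono (stage-⊔₃ m n o) t))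
  ... | reassociate r′ q′ = _ , (suc (m ⊔ n ⊔ o) , r′) , (suc (m ⊔ n ⊔ o) , q′)

  -- Stated through arbitrary members of the classes: atoms carry original labels, which need not be
  -- the least of their class.
  _●_▷_ : Class → Class → Class → Set
  a ● b ▷ c = ∃[ x ] ∃[ y ] ∃[ z ] (Rel x y z × [ x ] ≡ a × [ y ] ≡ b × [ z ] ≡ c)

  ▷-comm : ∀ {a b c} → a ● b ▷ c → b ● a ▷ c
  ▷-comm (x , y , z , r , p , q , s) = y , x , z , Rel-comm r , q , p , s

  canonical : Model
  canonical = record
    { frame = record
      { Carrier = Class
      ; R = _●_▷_
      ; e = [ ε ]
      ; unit⇒ = λ { a b (x , y , z , r , p , q , s) →
          trans (sym q) (trans ([]-cong (Rel-cancel r ([]-effective p))) s) }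
      ; unit⇐ = λ { a .a refl →
          ε , proj₁ a , proj₁ a , Rel-unit (proj₁ a) , refl , []-proj₁ a , []-proj₁ a }
      ; comm⇒ = λ _ _ _ → ▷-comm
      ; comm⇐ = λ _ _ _ → ▷-comm
      -- Rule `A` splits the first argument of an atom while the frame condition splits the second,
      -- so the atoms are commuted before and one of the results afterwards.
      ; assoc = λ { a b c d k (x , y , z , r , p , q , s) (u , v , w , r′ , p′ , q′ , s′) →
          let l , vlz , xul = Rel-assoc (Rel-comm r) (Rel-comm r′)
                                ([]-effective (trans s′ (sym q)))
          in [ l ] , (x , u , l , xul , p , p′ , refl) ,
                     (l , v , z , Rel-comm vlz , refl , q′ , s) }
      }
    ; val = λ p a → ∃[ m ] ∃[ x ] ((left , x ∶ atom p) ∈ H (stage m) × [ x ] ≡ a)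
    }

  -- Truth of all formulas that ever occur.

  Occurs : Signed → Set
  Occurs s = ∃[ m ] s ∈ H (stage m)

  decomposed : ∀ {s} → Occurs s →
               ∃[ m ] (Done (τ (stage m)) (Γₛ (stage m)) (H (stage m)) s ⊎ Inert s)
  decomposed (m , h) with progress {m} (decompose h)
  ... | decompose d = suc m , d

  combined-* : Occurs (right , z ∶ (F `* G)) → Rel x y w → w ∼ z →
               Occurs (right , x ∶ F) ⊎ Occurs (right , y ∶ G)
  combined-* (m , h) (n , r) (o , t)
    with progress {m ⊔ n ⊔ o}
      (combine-* (H-mono (stage-⊔₁ m n o) h)
                 (rel-mono (stage-⊔₂ m n o) r)
                 (τ-mono (stage-⊔₃ m n o) t))
  ... | combine-* d = Sum.map (suc (m ⊔ n ⊔ o) ,_) (suc (m ⊔ n ⊔ o) ,_) d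

  combined--* : Occurs (left , y ∶ (F `-* G)) → Rel x w z → w ∼ y →
                Occurs (right , x ∶ F) ⊎ Occurs (left , z ∶ G)
  combined--* (m , h) (n , r) (o , t)
    with progress {m ⊔ n ⊔ o}
      (combine--* (H-mono (stage-⊔₁ m n o) h)
                  (rel-mono (stage-⊔₂ m n o) r)
                  (τ-mono (stage-⊔₃ m n o) t))
  ... | combine--* d = Sum.map (suc (m ⊔ n ⊔ o) ,_) (suc (m ⊔ n ⊔ o) ,_) d

  -- Atomic formulas are never consumed. Both would therefore be active at a stage that identifies
  -- their labels, and the renamed sequent would be an instance of `id`.
  atoms-disjoint : Occurs (left , x ∶ atom n) → Occurs (right , y ∶ atom n) → ¬ x ∼ y
  atoms-disjoint {x} {p} {y} (m , h) (n , h′) (o , t)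
    with status (stage k) (H-mono (stage-⊔₁ m n o) h)
       | status (stage k) (H-mono (stage-⊔₂ m n o) h′)
    where k = m ⊔ n ⊔ o
  ... | inj₁ l | inj₁ r = underivable (stage k)
    (identity (subst (λ w → fm (w ∶ atom p) ∈ map (renA (τ (stage k))) (Γₛ (stage k)))
                (τ-mono (stage-⊔₃ m n o) t)
                (∈-map⁺ (renA (τ (stage k))) l))
              (∈-map⁺ (renF (τ (stage k))) r))
    where k = m ⊔ n ⊔ o

  ⊤*-apart : Occurs (right , x ∶ `⊤*) → ¬ x ∼ ε
  ⊤*-apart {x} (m , h) (n , t) with status (stage (m ⊔ n)) (H-mono (stage-mono (m≤m⊔n m n)) h)
  ... | inj₁ r = underivable (stage (m ⊔ n)) (⊤*-closes
    (subst (λ w → (w ∶ `⊤*) ∈ map (renF (τ (stage (m ⊔ n)))) (Δₛ (stage (m ⊔ n))))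
      (trans (τ-mono (stage-mono (m≤n⊔m m n)) t) (τ-ε (stage (m ⊔ n))))
      (∈-map⁺ (renF (τ (stage (m ⊔ n)))) r)))

  -- Simultaneous induction on the formula for all labels. `decomposed` supplies the subformulas of
  -- consumed formulas; for `-*` on the left and `*` on the right, `combined--*` and `combined-*`
  -- answer each atom separately.
  truthˡ : ∀ F {x} → Occurs (left , x ∶ F) → _⊨_ canonical [ x ] F
  truthʳ : ∀ F {x} → Occurs (right , x ∶ F) → ¬ _⊨_ canonical [ x ] F

  truthˡ (atom p) (m , h) = m , _ , h , refl
  truthˡ `⊤ _ = tt
  truthˡ `⊥ (m , h) with status (stage m) h
  ... | inj₁ act = underivable (stage m) (⊥-closes (∈-map⁺ (renA (τ (stage m))) act))
  truthˡ (F `∧ G) h with decomposed h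
  ... | m , inj₁ (p , q) = truthˡ F (m , p) , truthˡ G (m , q)
  truthˡ (F `→ G) h f with decomposed h
  ... | m , inj₁ (inj₁ p) = ⊥-elim (truthʳ F (m , p) f)
  ... | m , inj₁ (inj₂ q) = truthˡ G (m , q)
  truthˡ `⊤* h with decomposed h
  ... | m , inj₁ t = []-cong (m , t)
  truthˡ (F `* G) h with decomposed h
  ... | m , inj₁ (x , y , r , p , q) =
    [ x ] , [ y ] , (x , y , _ , (m , r) , refl , refl , refl) ,
    truthˡ F (m , p) , truthˡ G (m , q)
  truthˡ (F `-* G) h _ _ (y , x , z , r , p , refl , refl) f
    -- The calculus puts the label of a `-*` formula second in the atom, the semantics puts it
    -- first; hence `Rel-comm`.
    with combined--* h (Rel-comm r) ([]-effective p)
  ... | inj₁ o = ⊥-elim (truthʳ F o f)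
  ... | inj₂ o = truthˡ G o

  truthʳ (atom p) h (m , x , l , eq) = atoms-disjoint (m , l) h ([]-effective eq)
  truthʳ `⊤ (m , h) _ with status (stage m) h
  ... | inj₁ act = underivable (stage m) (⊤-closes (∈-map⁺ (renF (τ (stage m))) act))
  truthʳ `⊥ _ ()
  truthʳ (F `∧ G) h (f , g) with decomposed h
  ... | m , inj₁ (inj₁ p) = truthʳ F (m , p) f
  ... | m , inj₁ (inj₂ q) = truthʳ G (m , q) g
  truthʳ (F `→ G) h f with decomposed h
  ... | m , inj₁ (p , q) = truthʳ G (m , q) (f (truthˡ F (m , p)))
  truthʳ `⊤* h eq = ⊤*-apart h ([]-effective eq)
  truthʳ (F `* G) h (_ , _ , (x , y , z , r , refl , refl , s) , f , g)
    with combined-* h r ([]-effective s)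
  ... | inj₁ o = truthʳ F o f
  ... | inj₂ o = truthʳ G o g
  truthʳ (F `-* G) h f with decomposed h
  ... | m , inj₁ (x , z , r , p , q) =
    truthʳ G (m , q)
      (f [ x ] [ z ] (_ , x , z , Rel-comm (m , r) , refl , refl , refl) (truthˡ F (m , p)))

-- The initial state and completeness.

initial : ∀ F k → ¬ ([] ⊢ (var k ∶ F) ∷ []) → State
initial F k ¬d = record
  -- `k` itself occurs in the sequent, so fresh labels start at `suc k`.
  { N = suc k
  ; naming = record
    { τ = λ x → x ; τ-ε = refl ; τ-fresh = λ _ → refl ; τ-old = λ o → o }
  ; Γₛ = []
  ; Δₛ = (var k ∶ F) ∷ []
  ; H = (right , var k ∶ F) ∷ []
  ; Γ-old = []
  ; Δ-old = ≤-refl ∷ []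
  ; underivable = ¬d
  ; status = λ { (here refl) → inj₁ (here refl) } }

theorem2 : ExcludedMiddle 0ℓ → (A : Formula) → Valid A →
    (w : LVar) → [] ⊢ (var w ∶ unfoldAbbr A) ∷ []
theorem2 em B valid k with em {[] ⊢ (var k ∶ unfoldAbbr B) ∷ []}
... | yes d = d
... | no ¬d = ⊥-elim (truthʳ (unfoldAbbr B) (zero , here refl)
    (⊩⇒⊨ canonical em B (valid canonical [ var k ])))
  where
  open Countermodel em (initial (unfoldAbbr B) k ¬d)
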